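{- Let $G$ be a finite simple graph whose complement $\overline{G}$ is connected and satisfies $\operatorname{diam}(\overline{G})\geq 4$. Then $pc_{1,2}(G)\leq 3$.
   Context: All graphs are finite, undirected and simple. An edge-coloring is an arbitrary map from the edge set to a set of colors (adjacent edges may receive the same color). In an edge-colored graph, a path $P$ is a distance $2$-proper path if no two edges of $P$ of the same color appear with fewer than $2$ edges in between on $P$; equivalently, any two distinct edges of $P$ that are consecutive on $P$ or separated by exactly one edge of $P$ have different colors. The $(1,2)$-proper connection number $pc_{1,2}(G)$ is the minimum number of colors in an edge-coloring of $G$ such that every two distinct vertices of $G$ are joined by a distance $2$-proper path in $G$. The inequality $pc_{1,2}(G)\leq 3$ means that such a coloring with at most $3$ colors exists (in particular that $G$ is connected). -}

module Defs where

open import Data.Fin using (Fin; toℕ; _≟_)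
open import Data.List using (List; []; _∷_; length; lookup)
open import Data.List.Relation.Unary.Unique.Propositional using (Unique)
open import Data.Nat using (ℕ; zero; suc; _∸_; _≤_; _<_)
open import Data.Product using (Σ; Σ-syntax; ∃-syntax; _×_; _,_; proj₁)
open import Level using (0ℓ)
open import Relation.Binary using (Rel; Decidable; Symmetric; Irreflexive)
open import Relation.Binary.Construct.Closure.ReflexiveTransitive using (Star; ε; _◅_)
open import Relation.Binary.PropositionalEquality using (_≡_; _≢_; sym)
open import Relation.Nullary using (¬_)
open import Relation.Nullary.Decidable using (¬?; _×-dec_)

-- Adjacency is required to be decidable so that constructively a graph is the
-- same finite data as classically.
record Graph : Set₁ where
  field
    order      : ℕ
    Adj        : Rel (Fin order) 0ℓ
    adj?       : Decidable Adj
    adj-sym    : Symmetric Adj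
    adj-irrefl : Irreflexive _≡_ Adj

  Vertex : Set
  Vertex = Fin order

open Graph public using (Vertex)

complement : Graph → Graph
complement G = record
  { order      = order
  ; Adj        = λ u v → u ≢ v × ¬ Adj u v
  ; adj?       = λ u v → ¬? (u ≟ v) ×-dec ¬? (adj? u v)
  ; adj-sym    = λ (u≢v , ¬uv) → (λ v≡u → u≢v (sym v≡u)) , (λ vu → ¬uv (adj-sym vu))
  ; adj-irrefl = λ u≡v (u≢v , _) → u≢v u≡v
  }
  where open Graph G

module _ (G : Graph) where
  open Graph G using (Adj)

  Walk : Rel (Vertex G) 0ℓ
  Walk = Star Adj

  vertices : ∀ {u v} → Walk u v → List (Vertex G)
  vertices {u} ε       = u ∷ []
  vertices {u} (_ ◅ w) = u ∷ vertices w

  walkLength : ∀ {u v} → Walk u v → ℕ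
  walkLength ε       = zero
  walkLength (_ ◅ w) = suc (walkLength w)

  Path : Rel (Vertex G) 0ℓ
  Path u v = Σ[ w ∈ Walk u v ] Unique (vertices w)

  pathLength : ∀ {u v} → Path u v → ℕ
  pathLength P = walkLength (proj₁ P)

  Connected : Set
  Connected = ∀ u v → Path u v

  -- d is the length of a shortest path from u to v.
  IsDistance : Vertex G → Vertex G → ℕ → Set
  IsDistance u v d =
    (Σ[ P ∈ Path u v ] pathLength P ≡ d) × (∀ (P : Path u v) → d ≤ pathLength P)

  -- d is the maximum of the distances between two vertices; there is no such d
  -- if G is disconnected or has no vertices.
  IsDiameter : ℕ → Set
  IsDiameter d =
    (∀ u v → ∃[ k ] IsDistance u v k × k ≤ d) × (∃[ u ] ∃[ v ] IsDistance u v d)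

  -- An undirected edge is represented by any proof of Adj u v or of Adj v u.
  -- Applied twice, colour-sym also makes the colour independent of the choice of
  -- the proof of Adj u v.
  record EdgeColouring (k : ℕ) : Set where
    field
      colour     : ∀ {u v} → Adj u v → Fin k
      colour-sym : ∀ {u v} (e : Adj u v) (e′ : Adj v u) → colour e ≡ colour e′

  module _ {k : ℕ} (c : EdgeColouring k) where
    open EdgeColouring c

    walkColours : ∀ {u v} → Walk u v → List (Fin k)
    walkColours ε       = []
    walkColours (e ◅ w) = colour e ∷ walkColours w

    pathColours : ∀ {u v} → Path u v → List (Fin k)
    pathColours P = walkColours (proj₁ P)

    -- For positions i < j there are j ∸ suc i edges strictly in between.
    Distance2Proper : ∀ {u v} → Path u v → Set
    Distance2Proper P =
      ∀ (i j : Fin (length (pathColours P))) → toℕ i < toℕ j →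
      lookup (pathColours P) i ≡ lookup (pathColours P) j →
      2 ≤ toℕ j ∸ suc (toℕ i)

    Is[1,2]ProperConnected : Set
    Is[1,2]ProperConnected =
      ∀ u v → u ≢ v → Σ[ P ∈ Path u v ] Distance2Proper P

  -- The inequality pc₁,₂(G) ≤ m: such a colouring with at most m colours exists
  -- (the least number of colours of one is then at most m).
  pc₁,₂≤ : ℕ → Set
  pc₁,₂≤ m = ∃[ k ] k ≤ m × (Σ[ c ∈ EdgeColouring k ] Is[1,2]ProperConnected c)

-- Let dist be the distance in the complement to one end of a diametral pair, let
-- Vᵢ be the vertices with dist = i for i < 4, and V₄ those with dist ≥ 4.  All five
-- levels are inhabited, and vertices whose levels differ by at least 2 are adjacent
-- in G.  Fix bᵢ ∈ Vᵢ.  Edges are coloured by the levels of their ends: V₀V₂, V₁V₄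
-- get 0, V₀V₃, V₂V₄ get 1, V₀V₄ gets 2, and edges of V₁V₃ get 0 at b₃ and 1
-- elsewhere.  Two vertices whose levels differ by at most 1 are joined through at most
-- three of the bᵢ, taken from levels different from those of the two vertices.
module Submission where

open import Data.Empty using (⊥-elim)
open import Data.Fin using (Fin; toℕ; inject₁; _≟_)
open import Data.Fin.Patterns using (0F; 1F; 2F; 3F; 4F; 5F)
open import Data.Fin.Properties using (all?; toℕ-injective; toℕ≤pred[n])
open import Data.List using (List; []; _∷_; _∷ʳ_; length; lookup; map)
open import Data.List.Membership.Propositional using (_∈_)
open import Data.List.Membership.DecPropositional using (_∈?_)
open import Data.List.Relation.Unary.All as All using (All; []; _∷_)
import Data.List.Relation.Unary.All.Properties as All
open import Data.List.Relation.Unary.AllPairs using ([]; _∷_)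
open import Data.List.Relation.Unary.Any as Any using (Any; here; there)
open import Data.List.Relation.Unary.Linked as Linked using (Linked; [-]; _∷_; linked?)
import Data.List.Relation.Unary.Linked.Properties as Linked
open import Data.List.Relation.Unary.Unique.Propositional using (Unique)
import Data.List.Relation.Unary.Unique.Propositional.Properties as Unique
open import Data.List.Relation.Unary.Unique.DecPropositional using (unique?)
open import Data.Nat using (ℕ; suc; _+_; _∸_; _⊓_; _≤_; _<_; _≤?_; _<?_; z≤n)
open import Data.Nat.Properties
  using (≤-refl; ≤-trans; ≤-antisym; m≤n⇒m≤1+n; ⊓-mono-≤; ⊓-zeroʳ; <⇒≱; ≰⇒>)
open import Data.Product using (Σ-syntax; ∃-syntax; _×_; _,_; proj₁; proj₂)
open import Data.Sum using (_⊎_; inj₁; inj₂; [_,_]′)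
open import Data.Vec as Vec using (Vec; []; _∷_)
open import Function using (_∘_)
open import Relation.Binary using (Decidable)
open import Relation.Binary.Construct.Closure.ReflexiveTransitive using (ε; _◅_)
open import Relation.Binary.PropositionalEquality
  using (_≡_; _≢_; refl; sym; trans; cong; cong₂; subst; subst₂)
open import Relation.Nullary using (¬_; Dec; yes; no; contradiction)
open import Relation.Nullary.Decidable using (from-yes; ¬?; _×-dec_; _⊎-dec_; _→-dec_)
open import Defs

-- Walks and distances in a graph.

module _ (H : Graph) where
  open Graph H using (Adj)

  path-from : ∀ {a u v} (w : Walk H u v) → Unique (vertices H w) → a ∈ vertices H w →
              Σ[ Q ∈ Path H a v ] pathLength H Q ≤ walkLength H w
  path-from ε       w!       (here refl) = (ε , w!) , ≤-refl
  path-from (e ◅ w) w!       (here refl) = (e ◅ w , w!) , ≤-refl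
  path-from (e ◅ w) (_ ∷ w!) (there a∈w) with Q , Q≤w ← path-from w w! a∈w =
    Q , m≤n⇒m≤1+n Q≤w

  -- If `a` already lies on the path, prepending it would repeat a vertex; the part of the path from
  -- `a` onwards serves instead and is no longer.
  path-cons : ∀ {a u v} → Adj a u → (P : Path H u v) →
              Σ[ Q ∈ Path H a v ] pathLength H Q ≤ suc (pathLength H P)
  path-cons {a} e (w , w!) with _∈?_ _≟_ a (vertices H w)
  ... | yes a∈w with Q , Q≤w ← path-from w w! a∈w = Q , m≤n⇒m≤1+n Q≤w
  ... | no  a∉w = (e ◅ w , All.¬Any⇒All¬ _ a∉w ∷ w!) , ≤-refl

  IsDistance-step : ∀ {a b v k l} → Adj a b → IsDistance H a v k → IsDistance H b v l →
                    k ≤ suc l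
  IsDistance-step e (_ , k-min) ((P , refl) , _) with Q , Q≤P ← path-cons e P =
    ≤-trans (k-min Q) Q≤P

  IsDistance-minimal : ∀ {u v k l} → IsDistance H u v k → IsDistance H u v l → k ≤ l
  IsDistance-minimal (_ , k-min) ((P , refl) , _) = k-min P

  -- A discrete intermediate value argument: `f` falls by at most one per edge, so it cannot jump
  -- over `m`.
  walk-intermediate : (f : Vertex H → ℕ) → (∀ {a b} → Adj a b → f a ≤ suc (f b)) →
                      ∀ {u v m} → Walk H u v → f v ≤ m → m ≤ f u → ∃[ a ] f a ≡ m
  walk-intermediate f step {u} ε fv≤m m≤fu = u , ≤-antisym fv≤m m≤fu
  walk-intermediate f step {u} {m = m} (_◅_ {j = b} e w) fv≤m m≤fu with m ≤? f b
  ... | yes m≤fb = walk-intermediate f step w fv≤m m≤fb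
  -- Here `f b < m ≤ f u ≤ suc (f b)`.
  ... | no  m≰fb = u , ≤-antisym (≤-trans (step e) (≰⇒> m≰fb)) m≤fu

-- Kinds, their colours and the routes between them.

-- The kind of a vertex is its level, except that 3F is kept for b₃ alone and the other
-- vertices of V₃ are of kind 5F.
Kind : Set
Kind = Fin 6

level : Kind → ℕ
level 5F = 3
level k  = toℕ k

kindAtDistance : ℕ → Kind
kindAtDistance 0 = 0F
kindAtDistance 1 = 1F
kindAtDistance 2 = 2F
kindAtDistance 3 = 5F
kindAtDistance (suc (suc (suc (suc _)))) = 4F

kindAtDistance≢3F : ∀ n → kindAtDistance n ≢ 3F
kindAtDistance≢3F 0 ()
kindAtDistance≢3F 1 ()
kindAtDistance≢3F 2 ()
kindAtDistance≢3F 3 ()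
kindAtDistance≢3F (suc (suc (suc (suc _)))) ()

level-kindAtDistance : ∀ n → level (kindAtDistance n) ≡ n ⊓ 4
level-kindAtDistance 0 = refl
level-kindAtDistance 1 = refl
level-kindAtDistance 2 = refl
level-kindAtDistance 3 = refl
level-kindAtDistance (suc (suc (suc (suc n)))) = cong (4 +_) (sym (⊓-zeroʳ n))

kindAtDistance-toℕ : ∀ (i : Fin 5) → i ≢ 3F → kindAtDistance (toℕ i) ≡ inject₁ i
kindAtDistance-toℕ 0F _    = refl
kindAtDistance-toℕ 1F _    = refl
kindAtDistance-toℕ 2F _    = refl
kindAtDistance-toℕ 3F i≢3F = contradiction refl i≢3F
kindAtDistance-toℕ 4F _    = refl

Far : Kind → Kind → Set
Far k l = suc (level k) < level l ⊎ suc (level l) < level k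

far? : Decidable Far
far? k l = (suc (level k) <? level l) ⊎-dec (suc (level l) <? level k)

-- The entries between kinds that are not far apart are irrelevant.
colours : Vec (Vec (Fin 3) 6) 6
colours = (0F ∷ 0F ∷ 0F ∷ 1F ∷ 2F ∷ 1F ∷ [])
        ∷ (0F ∷ 0F ∷ 0F ∷ 0F ∷ 0F ∷ 1F ∷ [])
        ∷ (0F ∷ 0F ∷ 0F ∷ 0F ∷ 1F ∷ 0F ∷ [])
        ∷ (1F ∷ 0F ∷ 0F ∷ 0F ∷ 0F ∷ 0F ∷ [])
        ∷ (2F ∷ 0F ∷ 1F ∷ 0F ∷ 0F ∷ 0F ∷ [])
        ∷ (1F ∷ 1F ∷ 0F ∷ 0F ∷ 0F ∷ 0F ∷ [])
        ∷ []

kindColour : Kind → Kind → Fin 3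
kindColour k l = Vec.lookup (Vec.lookup colours k) l

kindColour-comm : ∀ k l → kindColour k l ≡ kindColour l k
kindColour-comm = from-yes (all? λ k → all? λ l → kindColour k l ≟ kindColour l k)

kindColours : List Kind → List (Fin 3)
kindColours (k ∷ l ∷ ks) = kindColour k l ∷ kindColours (l ∷ ks)
kindColours _            = []

Spaced : List (Fin 3) → Set
Spaced cs = ∀ (i j : Fin (length cs)) → toℕ i < toℕ j → lookup cs i ≡ lookup cs j →
            2 ≤ toℕ j ∸ suc (toℕ i)

spaced? : ∀ cs → Dec (Spaced cs)
spaced? cs = all? λ i → all? λ j →
  (toℕ i <? toℕ j) →-dec (lookup cs i ≟ lookup cs j) →-dec (2 ≤? toℕ j ∸ suc (toℕ i))

-- An entry i of the list stands for the intermediate vertex bᵢ.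
routeKinds : Kind → List (Fin 5) → Kind → List Kind
routeKinds k is l = k ∷ map inject₁ is ∷ʳ l

-- The ends may have the same kind, so `k` is compared with the intermediate kinds only.
IsRoute : Kind → Kind → List (Fin 5) → Set
IsRoute k l is = Linked Far (routeKinds k is l)
               × All (k ≢_) (map inject₁ is)
               × Unique (map inject₁ is ∷ʳ l)
               × Spaced (kindColours (routeKinds k is l))

isRoute? : ∀ k l is → Dec (IsRoute k l is)
isRoute? k l is = linked? far? _
            ×-dec All.all? (λ i → ¬? (k ≟ i)) _
            ×-dec unique? _≟_ _
            ×-dec spaced? (kindColours (routeKinds k is l))

-- The empty route is an edge between far levels. Through one vertex, `0F` joins V₃ to V₂ and V₄,
-- and `4F` joins V₁ to V₀ and V₂. The routes through two vertices join two vertices of V₄, of V₂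
-- and of V₀, in this order. Of those through three, the first two serve V₃ and the last V₁; there
-- only the first and last edges share a colour.
routes : List (List (Fin 5))
routes = []
       ∷ (0F ∷ [])
       ∷ (4F ∷ [])
       ∷ (0F ∷ 2F ∷ [])
       ∷ (0F ∷ 4F ∷ [])
       ∷ (2F ∷ 4F ∷ [])
       ∷ (0F ∷ 4F ∷ 1F ∷ [])
       ∷ (1F ∷ 4F ∷ 0F ∷ [])
       ∷ (3F ∷ 0F ∷ 4F ∷ [])
       ∷ []

-- A finite check. It shows why `b₃` is singled out: inside V₁ the route leaves for `b₃` by colour
-- 0, whereas inside V₃ the edge at `b₁` must have colour 1, and its other end can be chosen
-- different from `b₃`. The excluded pair would be `b₃` twice.
route : ∀ k l → ¬ (k ≡ 3F × l ≡ 3F) → Any (IsRoute k l) routes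
route = from-yes (all? λ k → all? λ l →
  ¬? ((k ≟ 3F) ×-dec (l ≟ 3F)) →-dec Any.any? (isRoute? k l) routes)

-- Lifting routes to paths in the graph.

module _ (G : Graph) (kind : Vertex G → Kind)
         (far⇒Adj : ∀ {u v} → Far (kind u) (kind v) → Graph.Adj G u v)
         (kind≡3F-unique : ∀ {u v} → kind u ≡ 3F → kind v ≡ 3F → u ≡ v)
         (b : Fin 5 → Vertex G) (kind-b : ∀ i → kind (b i) ≡ inject₁ i) where
  open Graph G using (Adj)

  kindColouring : EdgeColouring G 3
  kindColouring = record
    { colour     = λ {u} {v} _ → kindColour (kind u) (kind v)
    ; colour-sym = λ {u} {v} _ _ → kindColour-comm (kind u) (kind v)
    }

  walkThrough : ∀ s xs t → Linked Adj (s ∷ xs ∷ʳ t) → Walk G s t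
  walkThrough s []       t (e ∷ [-]) = e ◅ ε
  walkThrough s (x ∷ xs) t (e ∷ es)  = e ◅ walkThrough x xs t es

  vertices-walkThrough : ∀ s xs t es → vertices G (walkThrough s xs t es) ≡ s ∷ xs ∷ʳ t
  vertices-walkThrough s []       t (e ∷ [-]) = refl
  vertices-walkThrough s (x ∷ xs) t (e ∷ es)  = cong (s ∷_) (vertices-walkThrough x xs t es)

  walkColours-walkThrough : ∀ s xs t es →
    walkColours G kindColouring (walkThrough s xs t es) ≡ kindColours (map kind (s ∷ xs ∷ʳ t))
  walkColours-walkThrough s []       t (e ∷ [-]) = refl
  walkColours-walkThrough s (x ∷ xs) t (e ∷ es)  =
    cong (kindColour (kind s) (kind x) ∷_) (walkColours-walkThrough x xs t es)

  map-kind-b : ∀ is t → map kind (map b is ∷ʳ t) ≡ map inject₁ is ∷ʳ kind t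
  map-kind-b []       t = refl
  map-kind-b (i ∷ is) t = cong₂ _∷_ (kind-b i) (map-kind-b is t)

  routePath : ∀ {s t} is → s ≢ t → IsRoute (kind s) (kind t) is →
              Σ[ P ∈ Path G s t ] Distance2Proper G kindColouring P
  routePath {s} {t} is s≢t (far , s∉is , is! , spaced) = (w , w!) , w-spaced
    where
    es : Linked Adj (s ∷ map b is ∷ʳ t)
    es = Linked.map far⇒Adj
      (Linked.map⁻ (subst (Linked Far) (cong (kind s ∷_) (sym (map-kind-b is t))) far))

    w : Walk G s t
    w = walkThrough s (map b is) t es

    s∉b : All (s ≢_) (map b is)
    s∉b = All.map⁺ (All.map (λ {i} k≢i s≡bi → k≢i (trans (cong kind s≡bi) (kind-b i)))
                            (All.map⁻ s∉is))

    -- The ends differ by hypothesis, any other two vertices because their kinds do.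
    w! : Unique (vertices G w)
    w! = subst Unique (sym (vertices-walkThrough s (map b is) t es))
      ( All.++⁺ s∉b (s≢t ∷ [])
      ∷ Unique.map⁻ (subst Unique (sym (map-kind-b is t)) is!))

    w-spaced : Spaced (walkColours G kindColouring w)
    w-spaced = subst Spaced
      (sym (trans (walkColours-walkThrough s (map b is) t es)
                  (cong (kindColours ∘ (kind s ∷_)) (map-kind-b is t))))
      spaced

  kindColouring-properConnected : Is[1,2]ProperConnected G kindColouring
  kindColouring-properConnected s t s≢t =
    let is , r = Any.satisfied (route (kind s) (kind t) (λ (p , q) → s≢t (kind≡3F-unique p q)))
    in routePath is s≢t r

-- Kinds from distances in the complement.

module _ (G : Graph) (dist : Vertex G → ℕ)
         (dist-step : ∀ {a b} → Graph.Adj (complement G) a b → dist a ≤ suc (dist b))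
         (b : Fin 5 → Vertex G) (dist-b : ∀ i → dist (b i) ≡ toℕ i) where
  open Graph G using (Adj; adj?)

  kind : Vertex G → Kind
  kind v with v ≟ b 3F
  ... | yes _ = 3F
  ... | no  _ = kindAtDistance (dist v)

  level-kind : ∀ v → level (kind v) ≡ dist v ⊓ 4
  level-kind v with v ≟ b 3F
  ... | yes refl = cong (_⊓ 4) (sym (dist-b 3F))
  ... | no  _    = level-kindAtDistance (dist v)

  kind-step : ∀ {u v} → Graph.Adj (complement G) u v → level (kind u) ≤ suc (level (kind v))
  kind-step {u} {v} e = subst₂ (λ m n → m ≤ suc n) (sym (level-kind u)) (sym (level-kind v))
    -- `suc (dist v ⊓ 4)` computes to `suc (dist v) ⊓ 5`, hence the comparison of 4 with 5.
    (⊓-mono-≤ (dist-step e) (m≤n⇒m≤1+n (≤-refl {4})))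

  far⇒≢ : ∀ {u v} → Far (kind u) (kind v) → u ≢ v
  far⇒≢ (inj₁ k+1<k) refl = <⇒≱ k+1<k (m≤n⇒m≤1+n ≤-refl)
  far⇒≢ (inj₂ k+1<k) refl = <⇒≱ k+1<k (m≤n⇒m≤1+n ≤-refl)

  -- A missing edge would be an edge of the complement, along which levels change by at most one.
  far⇒Adj : ∀ {u v} → Far (kind u) (kind v) → Adj u v
  far⇒Adj {u} {v} far with adj? u v
  ... | yes uv = uv
  ... | no ¬uv = ⊥-elim ([ (λ lt → <⇒≱ lt (kind-step (Graph.adj-sym (complement G) e)))
                         , (λ lt → <⇒≱ lt (kind-step e)) ]′ far)
    where
    e : Graph.Adj (complement G) u v
    e = far⇒≢ far , ¬uv

  kind≡3F⇒≡b : ∀ {v} → kind v ≡ 3F → v ≡ b 3F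
  kind≡3F⇒≡b {v} eq with v ≟ b 3F
  ... | yes v≡b = v≡b
  ... | no  _   = contradiction eq (kindAtDistance≢3F (dist v))

  kind-b : ∀ i → kind (b i) ≡ inject₁ i
  kind-b i with b i ≟ b 3F
  -- Since `dist (b i)` is `toℕ i`, this case forces `i` to be `3F`.
  ... | yes bi≡b3 = cong inject₁ (toℕ-injective
                      (trans (sym (dist-b 3F)) (trans (cong dist (sym bi≡b3)) (dist-b i))))
  ... | no  bi≢b3 = trans (cong kindAtDistance (dist-b i))
                          (kindAtDistance-toℕ i (bi≢b3 ∘ cong b))

  levels⇒pc₁,₂≤3 : pc₁,₂≤ G 3
  levels⇒pc₁,₂≤3 = 3 , ≤-refl , kindColouring G kind far⇒Adj kind≡3F-unique b kind-b
                 , kindColouring-properConnected G kind far⇒Adj kind≡3F-unique b kind-b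
    where
    kind≡3F-unique : ∀ {u v} → kind u ≡ 3F → kind v ≡ 3F → u ≡ v
    kind≡3F-unique p q = trans (kind≡3F⇒≡b p) (sym (kind≡3F⇒≡b q))

theorem3p1 : (G : Graph) (d : ℕ) →
    Connected (complement G) →
    IsDiameter (complement G) d →
    4 ≤ d →
    pc₁,₂≤ G 3
theorem3p1 G d conn (distances , u , r , ud) 4≤d =
  levels⇒pc₁,₂≤3 G dist dist-step (proj₁ ∘ atLevel) (proj₂ ∘ atLevel)
  where
  H : Graph
  H = complement G

  dist : Vertex G → ℕ
  dist v = proj₁ (distances v r)

  isDistance : ∀ v → IsDistance H v r (dist v)
  isDistance v = proj₁ (proj₂ (distances v r))

  dist-step : ∀ {a b} → Graph.Adj H a b → dist a ≤ suc (dist b)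
  dist-step {a} {b} e = IsDistance-step H e (isDistance a) (isDistance b)

  dist-r≤0 : dist r ≤ 0
  dist-r≤0 = proj₂ (isDistance r) (ε , [] ∷ [])

  4≤dist-u : 4 ≤ dist u
  4≤dist-u = ≤-trans 4≤d (IsDistance-minimal H ud (isDistance u))

  atLevel : (i : Fin 5) → ∃[ v ] dist v ≡ toℕ i
  -- Any walk from `u` to `r` descends from distance at least 4 to 0, so it meets each of the
  -- distances 0 to 4 exactly.
  atLevel i = walk-intermediate H dist dist-step (proj₁ (conn u r))
    (≤-trans dist-r≤0 z≤n) (≤-trans (toℕ≤pred[n] i) 4≤dist-u)
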